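{- Let $\Gamma$ be a connected bipartite graph with at least one edge, and suppose that its line graph $G=\mathrm{L}(\Gamma)$ is integral. Then the diameter of $G$ is at most $2\omega(G)$, where $\omega(G)$ is the clique number of $G$.
   Context: All graphs are finite and simple. A graph is integral if all eigenvalues of its adjacency matrix are integers. The line graph $\mathrm{L}(\Gamma)$ has the edges of $\Gamma$ as vertices, two distinct edges being adjacent when they share an endpoint. The clique number $\omega(G)$ is the maximum number of vertices in a complete subgraph of $G$. -}

module Defs where

open import Level using (0ℓ; _⊔_) renaming (suc to lsuc)
open import Algebra.Apartness.Bundles using (HeytingField; HeytingCommutativeRing)
open import Algebra.Bundles using (CommutativeRing; Semiring)
import Algebra.Definitions.RawSemiring as RawSemiringDefs
open import Data.Bool.Base using (Bool; if_then_else_)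
open import Data.Fin.Base using (Fin; toℕ; _<_)
open import Data.Fin.Properties using (_≟_; _<?_; any?)
open import Data.Fin.Subset using (Subset; _∈_; ∣_∣)
open import Data.Integer.Base using (ℤ; +_; -[1+_])
open import Data.List.Base using (List; allFin; cartesianProduct; filter; length; lookup)
open import Data.Nat.Base using (ℕ; suc; _≤_)
open import Data.Product.Base using (_×_; _,_; proj₁; ∃-syntax; Σ-syntax)
open import Data.Sum.Base using (_⊎_)
open import Data.Vec.Functional using (Vector)
open import Relation.Binary.Core using (Rel)
open import Relation.Binary.Definitions using (Decidable; Irreflexive; Symmetric)
open import Relation.Binary.PropositionalEquality.Core using (_≡_; _≢_; ≢-sym)
open import Relation.Nullary.Decidable using (does; ¬?; _×-dec_; _⊎-dec_)
open import Relation.Nullary.Negation using (¬_)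
import Relation.Unary as Unary

------------------------------------------------------------------------
-- Finite simple graphs

record Graph : Set₁ where
  infix 4 _~_ _~?_
  field
    order    : ℕ
    _~_      : Rel (Fin order) 0ℓ
    _~?_     : Decidable _~_
    ~-sym    : Symmetric _~_
    ~-irrefl : Irreflexive _≡_ _~_

  Vertex : Set
  Vertex = Fin order

module _ (G : Graph) where
  open Graph G

  infixr 5 _∷_
  data Walk : Vertex → Vertex → ℕ → Set where
    []  : ∀ {u} → Walk u u 0
    _∷_ : ∀ {u v w k} → u ~ v → Walk v w k → Walk u w (suc k)

  HasEdge : Set
  HasEdge = ∃[ u ] ∃[ v ] u ~ v

  -- The graph of order zero also satisfies this.
  Connected : Set
  Connected = ∀ u v → ∃[ k ] Walk u v k

  Bipartite : Set
  Bipartite = Σ[ side ∈ (Vertex → Bool) ] (∀ {u v} → u ~ v → side u ≢ side v)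

  IsDistance : Vertex → Vertex → ℕ → Set
  IsDistance u v d = Walk u v d × (∀ k → Walk u v k → d ≤ k)

  -- The first component says in particular that all distances are finite.
  IsDiameter : ℕ → Set
  IsDiameter D = (∀ u v → ∃[ d ] IsDistance u v d × d ≤ D)
               × (∃[ u ] ∃[ v ] IsDistance u v D)

  IsClique : Subset order → Set
  IsClique S = ∀ {u v} → u ∈ S → v ∈ S → u ≢ v → u ~ v

  IsCliqueNumber : ℕ → Set
  IsCliqueNumber w = (∃[ S ] IsClique S × ∣ S ∣ ≡ w)
                   × (∀ S → IsClique S → ∣ S ∣ ≤ w)

------------------------------------------------------------------------
-- Line graphs

  -- Each edge is listed exactly once, as the pair (u , v) with u < v.
  IsEdge : Unary.Pred (Vertex × Vertex) 0ℓ
  IsEdge (u , v) = u < v × u ~ v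

  isEdge? : Unary.Decidable IsEdge
  isEdge? (u , v) = u <? v ×-dec u ~? v

  edges : List (Vertex × Vertex)
  edges = filter isEdge? (cartesianProduct (allFin order) (allFin order))

  IsEndpoint : Vertex → Vertex × Vertex → Set
  IsEndpoint x (u , v) = x ≡ u ⊎ x ≡ v

  isEndpoint? : Decidable IsEndpoint
  isEndpoint? x (u , v) = x ≟ u ⊎-dec x ≟ v

  LineAdjacent : Rel (Fin (length edges)) 0ℓ
  LineAdjacent e f =
    e ≢ f × (∃[ x ] IsEndpoint x (lookup edges e) × IsEndpoint x (lookup edges f))

  lineGraph : Graph
  lineGraph = record
    { order    = length edges
    ; _~_      = LineAdjacent
    ; _~?_     = λ e f → ¬? (e ≟ f) ×-dec
                   any? (λ x → isEndpoint? x (lookup edges e) ×-dec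
                               isEndpoint? x (lookup edges f))
    ; ~-sym    = λ (e≢f , x , x∈e , x∈f) → ≢-sym e≢f , x , x∈f , x∈e
    ; ~-irrefl = λ e≡f e~f → proj₁ e~f e≡f
    }

------------------------------------------------------------------------
-- Eigenvalues

-- The library has no complex numbers.  This interface stands in for ℂ:
-- a field of characteristic zero in which every monic polynomial of
-- positive degree has a root.
record AlgebraicallyClosedField c ℓ₁ ℓ₂ : Set (lsuc (c ⊔ ℓ₁ ⊔ ℓ₂)) where
  field
    heytingField : HeytingField c ℓ₁ ℓ₂

  open HeytingField heytingField public
  open HeytingCommutativeRing heytingCommutativeRing public using (commutativeRing)
  open CommutativeRing commutativeRing public using (semiring)
  open Semiring semiring public using (rawSemiring)
  open RawSemiringDefs rawSemiring public using (sum; _^_) renaming (_×_ to _·_)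

  field
    characteristicZero : ∀ n → ¬ (suc n · 1# ≈ 0#)
    hasRoot : ∀ {n} (a : Vector Carrier (suc n)) →
              ∃[ x ] x ^ suc n + sum (λ i → a i * x ^ toℕ i) ≈ 0#

  fromℤ : ℤ → Carrier
  fromℤ (+ n)    = n · 1#
  fromℤ -[1+ n ] = - (suc n · 1#)

module _ {c ℓ₁ ℓ₂} (K : AlgebraicallyClosedField c ℓ₁ ℓ₂) where
  open AlgebraicallyClosedField K

  -- A vector is nonzero when some entry is apart from 0.
  IsEigenvalue : ∀ {n} → (Fin n → Fin n → Carrier) → Carrier → Set (c ⊔ ℓ₁ ⊔ ℓ₂)
  IsEigenvalue {n} A μ =
    Σ[ v ∈ Vector Carrier n ] (∃[ i ] v i # 0#) × (∀ i → sum (λ j → A i j * v j) ≈ μ * v i)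

  adjacencyMatrix : (G : Graph) → Graph.Vertex G → Graph.Vertex G → Carrier
  adjacencyMatrix G i j = if does (i ~? j) then 1# else 0#
    where open Graph G

  Integral : Graph → Set (c ⊔ ℓ₁ ⊔ ℓ₂)
  Integral G = ∀ μ → IsEigenvalue (adjacencyMatrix G) μ → ∃[ k ] μ ≈ fromℤ k

{-# OPTIONS --safe #-}

-- Let A be the adjacency matrix of L(Γ) and N the vertex-edge incidence matrix of
-- Γ, so that A + 2 = Nᵀ N.  Every star of Γ is a clique of L(Γ), so the row sums of
-- N are at most ω, its column sums are 2, and an integer eigenvalue k of A
-- satisfies 0 ≤ k + 2 ≤ 2ω.  If the diameter D exceeded 2ω, the polynomial
-- p = ∏_{j < D} (x − (j − 2)) would vanish at all eigenvalues, giving p(A) = 0 as A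
-- is symmetric; but p is monic of degree D, so the entry of p(A) at two vertices at
-- distance D counts the shortest walks between them.
--
-- Eigenvalues in the field are needed only to find, for an integer vector w,
-- integers kᵢ with ∏ (A − kᵢ) w = 0; from there on everything happens over ℤ.  The
-- bound on D is decidable, so that case distinctions on elements of the field may
-- be made under a double negation.
module Submission where

open import Defs
open import Algebra.Bundles using (CommutativeRing)
import Algebra.Properties.AbelianGroup as AbelianGroupProperties
import Algebra.Properties.Ring as RingProperties
import Algebra.Properties.Semiring.Mult as SemiringMult
import Algebra.Properties.Semiring.Sum as SemiringSum
import Algebra.Solver.Ring as RingSolver
open import Algebra.Solver.Ring.AlmostCommutativeRing using (fromCommutativeRing; _-Raw-AlmostCommutative⟶_)
open import Data.Bool.Base using (Bool; true; false; if_then_else_)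
open import Data.Fin.Base as Fin using (Fin; zero; suc; toℕ; punchIn; punchOut)
import Data.Fin.Properties as Fin
open import Data.Fin.Subset as Subset using (Subset)
import Data.Fin.Subset.Properties as Subset
open import Data.Integer.Base as ℤ using (ℤ; +_; -[1+_]; 0ℤ; 1ℤ; ∣_∣)
import Data.Integer.Properties as ℤ
open import Data.Integer.Tactic.RingSolver using (solve-∀)
open import Data.List.Base as List using (List; []; _∷_)
open import Data.List.Membership.Propositional using (_∈_)
open import Data.List.Membership.Propositional.Properties
  using (∈-filter⁺; ∈-filter⁻; ∈-cartesianProduct⁺; ∈-allFin; ∈-lookup; ∈-applyUpTo⁺)
import Data.List.Properties as List
import Data.List.Relation.Unary.All as All
open import Data.List.Relation.Unary.AllPairs using (_∷_)
open import Data.List.Relation.Unary.Any using (here; there; index)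
open import Data.List.Relation.Unary.Any.Properties using (lookup-index)
open import Data.List.Relation.Unary.Unique.Propositional using (Unique)
open import Data.List.Relation.Unary.Unique.Propositional.Properties using (filter⁺; cartesianProduct⁺; allFin⁺)
open import Data.Maybe.Base using (Maybe; just; nothing)
open import Data.Nat.Base as ℕ using (ℕ; zero; suc)
import Data.Nat.Properties as ℕ
open import Data.Product.Base using (_×_; _,_; ∃-syntax; proj₁; proj₂)
open import Data.Sum.Base using (_⊎_; inj₁; inj₂)
open import Data.Vec.Base as Vec using (Vec; []; _∷_)
open import Data.Vec.Functional using (Vector)
open import Data.Vec.Properties using ([]=⇒lookup; lookup∘tabulate)
open import Function.Base using (_∘_)
open import Relation.Binary.Definitions using (tri<; tri≈; tri>)
open import Relation.Binary.PropositionalEquality as ≡ using (_≡_; _≢_)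
open import Relation.Nullary.Decidable
  using (Dec; yes; no; does; map′; ¬?; _×-dec_; _→-dec_; dec-true; dec-false; decidable-stable)
open import Relation.Nullary.Negation using (¬_; contradiction)
open import Relation.Unary using (Decidable)

-- The canonical homomorphism from the integers to a commutative ring.

module IntegerMultiples {c ℓ} (R : CommutativeRing c ℓ) where
  open CommutativeRing R
  open RingProperties ring using (-‿distribˡ-*; -‿distribʳ-*)
  open AbelianGroupProperties +-abelianGroup using (⁻¹-∙-comm; ⁻¹-involutive; ε⁻¹≈ε)
  open SemiringMult semiring using (×1-homo-*; ×-homo-+; ×-homo-1) renaming (_×_ to _·_)
  open import Relation.Binary.Reasoning.Setoid setoid

  ⟦_⟧ : ℤ → Carrier
  ⟦ + n ⟧      = n · 1#
  ⟦ -[1+ n ] ⟧ = - (suc n · 1#)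

  ⟦⟧-homo-⊖ : ∀ m n → ⟦ m ℤ.⊖ n ⟧ ≈ m · 1# - n · 1#
  ⟦⟧-homo-⊖ m zero = sym (trans (+-congˡ ε⁻¹≈ε) (+-identityʳ _))
  ⟦⟧-homo-⊖ zero (suc n) = sym (+-identityˡ _)
  ⟦⟧-homo-⊖ (suc m) (suc n) = begin
    ⟦ suc m ℤ.⊖ suc n ⟧                 ≡⟨ ≡.cong ⟦_⟧ (ℤ.[1+m]⊖[1+n]≡m⊖n m n) ⟩
    ⟦ m ℤ.⊖ n ⟧                         ≈⟨ ⟦⟧-homo-⊖ m n ⟩
    m · 1# - n · 1#                     ≈⟨ +-congʳ (+-identityʳ _) ⟨
    m · 1# + 0# - n · 1#                ≈⟨ +-congʳ (+-congˡ (-‿inverseʳ 1#)) ⟨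
    m · 1# + (1# - 1#) - n · 1#         ≈⟨ +-congʳ (+-assoc _ _ _) ⟨
    m · 1# + 1# - 1# - n · 1#           ≈⟨ +-assoc _ _ _ ⟩
    m · 1# + 1# + (- 1# - n · 1#)       ≈⟨ +-cong (+-comm _ _) (⁻¹-∙-comm _ _) ⟩
    suc m · 1# - suc n · 1#             ∎

  ⟦⟧-homo-+ : ∀ i j → ⟦ i ℤ.+ j ⟧ ≈ ⟦ i ⟧ + ⟦ j ⟧
  ⟦⟧-homo-+ (+ m)      (+ n)      = ×-homo-+ 1# m n
  ⟦⟧-homo-+ (+ m)      -[1+ n ]   = ⟦⟧-homo-⊖ m (suc n)
  ⟦⟧-homo-+ -[1+ m ]   (+ n)      = trans (⟦⟧-homo-⊖ n (suc m)) (+-comm _ _)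
  ⟦⟧-homo-+ -[1+ m ]   -[1+ n ]   = begin
    - (1# + (1# + (m ℕ.+ n) · 1#))    ≈⟨ -‿cong (+-congˡ (+-congˡ (×-homo-+ 1# m n))) ⟩
    - (1# + (1# + (m · 1# + n · 1#))) ≈⟨ -‿cong (+-congˡ (trans (sym (+-assoc _ _ _)) (trans (+-congʳ (+-comm _ _)) (+-assoc _ _ _)))) ⟩
    - (1# + (m · 1# + suc n · 1#))    ≈⟨ -‿cong (+-assoc _ _ _) ⟨
    - (suc m · 1# + suc n · 1#)       ≈⟨ ⁻¹-∙-comm _ _ ⟨
    - (suc m · 1#) - suc n · 1#       ∎

  ⟦⟧-homo-neg : ∀ i → ⟦ ℤ.- i ⟧ ≈ - ⟦ i ⟧
  ⟦⟧-homo-neg (+ zero)  = sym ε⁻¹≈ε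
  ⟦⟧-homo-neg (+ suc n) = refl
  ⟦⟧-homo-neg -[1+ n ]  = sym (⁻¹-involutive _)

  ⟦⟧-homo-+* : ∀ m j → ⟦ + m ℤ.* j ⟧ ≈ ⟦ + m ⟧ * ⟦ j ⟧
  ⟦⟧-homo-+* m (+ n) = trans (reflexive (≡.cong ⟦_⟧ (≡.sym (ℤ.pos-* m n)))) (×1-homo-* m n)
  ⟦⟧-homo-+* m -[1+ n ] = begin
    ⟦ + m ℤ.* -[1+ n ] ⟧       ≡⟨ ≡.cong ⟦_⟧ (ℤ.neg-distribʳ-* (+ m) (+ suc n)) ⟨
    ⟦ ℤ.- (+ m ℤ.* + suc n) ⟧  ≈⟨ ⟦⟧-homo-neg (+ m ℤ.* + suc n) ⟩
    - ⟦ + m ℤ.* + suc n ⟧      ≈⟨ -‿cong (⟦⟧-homo-+* m (+ suc n)) ⟩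
    - (m · 1# * (suc n · 1#))    ≈⟨ -‿distribʳ-* _ _ ⟩
    m · 1# * - (suc n · 1#)    ∎

  ⟦⟧-homo-* : ∀ i j → ⟦ i ℤ.* j ⟧ ≈ ⟦ i ⟧ * ⟦ j ⟧
  ⟦⟧-homo-* (+ m) j = ⟦⟧-homo-+* m j
  ⟦⟧-homo-* -[1+ m ] j = begin
    ⟦ -[1+ m ] ℤ.* j ⟧        ≡⟨ ≡.cong ⟦_⟧ (ℤ.neg-distribˡ-* (+ suc m) j) ⟨
    ⟦ ℤ.- (+ suc m ℤ.* j) ⟧   ≈⟨ ⟦⟧-homo-neg (+ suc m ℤ.* j) ⟩
    - ⟦ + suc m ℤ.* j ⟧       ≈⟨ -‿cong (⟦⟧-homo-+* (suc m) j) ⟩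
    - (suc m · 1# * ⟦ j ⟧)    ≈⟨ -‿distribˡ-* _ _ ⟩
    - (suc m · 1#) * ⟦ j ⟧    ∎

  -- Makes the ring solver normalise with integer coefficients, whose equality is decidable even
  -- where that of the ring is not.
  integerCoefficients : ℤ.+-*-rawRing -Raw-AlmostCommutative⟶ fromCommutativeRing R
  integerCoefficients = record
    { ⟦_⟧    = ⟦_⟧
    ; +-homo = ⟦⟧-homo-+
    ; *-homo = ⟦⟧-homo-*
    ; -‿homo = ⟦⟧-homo-neg
    ; 0-homo = refl
    ; 1-homo = ×-homo-1 1#
    }

  ⟦⟧-≟ : ∀ i j → Maybe (⟦ i ⟧ ≈ ⟦ j ⟧)
  ⟦⟧-≟ i j with i ℤ.≟ j
  ... | yes i≡j = just (reflexive (≡.cong ⟦_⟧ i≡j))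
  ... | no _    = nothing

  open RingSolver ℤ.+-*-rawRing (fromCommutativeRing R) integerCoefficients ⟦⟧-≟ public
    using (solve; _:=_; _:+_; _:*_; _:-_; :-_; con)

-- Linear combinations and monic polynomials over a commutative ring.

module LinearCombination {c ℓ} (R : CommutativeRing c ℓ) where
  open CommutativeRing R
  open IntegerMultiples R

  -- Only the first `m` terms of `f` enter. Taking a whole sequence lets the length of a linear
  -- dependence be found afterwards.
  combine : ∀ {m} → Vec Carrier m → (ℕ → Carrier) → Carrier
  combine []       f = 0#
  combine (c ∷ cs) f = c * f 0 + combine cs (f ∘ suc)

  combine-linear : ∀ {m} (cs : Vec Carrier m) f h a →
                   combine cs (λ k → f k - h k * a) ≈ combine cs f - combine cs h * a
  combine-linear []       f h a = solve 1 (λ a → con (+ 0) := con (+ 0) :- con (+ 0) :* a) refl a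
  combine-linear (c ∷ cs) f h a = trans (+-congˡ (combine-linear cs (f ∘ suc) (h ∘ suc) a))
    (solve 6 (λ c f h a x y → c :* (f :- h :* a) :+ (x :- y :* a) := c :* f :+ x :- (c :* h :+ y) :* a) refl
      c (f 0) (h 0) a (combine cs (f ∘ suc)) (combine cs (h ∘ suc)))

  combine-zero : ∀ {m} (cs : Vec Carrier m) {f} → (∀ k → f k ≈ 0#) → combine cs f ≈ 0#
  combine-zero []       f≈0 = refl
  combine-zero (c ∷ cs) f≈0 = trans (+-cong (trans (*-congˡ (f≈0 0)) (zeroʳ c)) (combine-zero cs (f≈0 ∘ suc))) (+-identityˡ 0#)

module MonicPolynomial {c ℓ} (R : CommutativeRing c ℓ) where
  open CommutativeRing R

  -- A vector of coefficients c₀ , … , c_{d-1} stands for the monic polynomial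
  -- x^d + c_{d-1} x^{d-1} + … + c₀.
  evaluate : ∀ {d} → Vec Carrier d → Carrier → Carrier
  evaluate []      x = 1#
  evaluate (c ∷ p) x = c + x * evaluate p x

  -- Horner's scheme: the quotient of c ∷ p by x − μ does not depend on c.
  quotient : ∀ {d} → Carrier → Vec Carrier d → Vec Carrier d
  quotient μ []      = []
  quotient μ (c ∷ p) = evaluate (c ∷ p) μ ∷ quotient μ p

-- Polynomials in a square matrix, acting on vectors.

module MatrixAction {c ℓ} (R : CommutativeRing c ℓ) {n : ℕ} (A : Fin n → Fin n → CommutativeRing.Carrier R) where
  open CommutativeRing R
  open IntegerMultiples R
  open LinearCombination R
  open MonicPolynomial R
  open SemiringSum semiring using (sum; sum-cong-≋; ∑-distrib-+; *-distribˡ-sum)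
  open import Relation.Binary.Reasoning.Setoid setoid

  infix 4 _≋_
  _≋_ : Vector Carrier n → Vector Carrier n → Set ℓ
  v ≋ w = ∀ i → v i ≈ w i

  apply : Vector Carrier n → Vector Carrier n
  apply w i = sum (λ j → A i j * w j)

  shift : Carrier → Vector Carrier n → Vector Carrier n
  shift k w i = apply w i - k * w i

  -- The product of the factors A - k, for k in the list, applied to a vector. The order is
  -- immaterial because the factors commute.
  shifts : List Carrier → Vector Carrier n → Vector Carrier n
  shifts []       w = w
  shifts (k ∷ ks) w = shifts ks (shift k w)

  apply-cong : ∀ {v w} → v ≋ w → apply v ≋ apply w
  apply-cong v≋w i = sum-cong-≋ (λ j → *-congˡ (v≋w j))

  apply-linear : ∀ a v w → apply (λ i → a * v i + w i) ≋ (λ i → a * apply v i + apply w i)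
  apply-linear a v w i = begin
    sum (λ j → A i j * (a * v j + w j))
      ≈⟨ sum-cong-≋ (λ j → solve 4 (λ x a v w → x :* (a :* v :+ w) := a :* (x :* v) :+ x :* w) refl (A i j) a (v j) (w j)) ⟩
    sum (λ j → a * (A i j * v j) + A i j * w j)
      ≈⟨ ∑-distrib-+ (λ j → a * (A i j * v j)) (λ j → A i j * w j) ⟩
    sum (λ j → a * (A i j * v j)) + apply w i
      ≈⟨ +-congʳ (*-distribˡ-sum a (λ j → A i j * v j)) ⟨
    a * apply v i + apply w i ∎

  shift-cong : ∀ k {v w} → v ≋ w → shift k v ≋ shift k w
  shift-cong k v≋w i = +-cong (apply-cong v≋w i) (-‿cong (*-congˡ (v≋w i)))

  shift-congˡ : ∀ {k l} → k ≈ l → ∀ w → shift k w ≋ shift l w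
  shift-congˡ k≈l w i = +-congˡ (-‿cong (*-congʳ k≈l))

  shift-linear : ∀ k a v w → shift k (λ i → a * v i + w i) ≋ (λ i → a * shift k v i + shift k w i)
  shift-linear k a v w i = trans (+-congʳ (apply-linear a v w i))
    (solve 6 (λ k a x y v w → a :* x :+ y :- k :* (a :* v :+ w) := a :* (x :- k :* v) :+ (y :- k :* w)) refl
      k a (apply v i) (apply w i) (v i) (w i))

  apply-shift : ∀ k w → apply (shift k w) ≋ shift k (apply w)
  apply-shift k w i = begin
    apply (shift k w) i                       ≈⟨ apply-cong (λ j → solve 3 (λ x k w → x :- k :* w := (:- k) :* w :+ x) refl (apply w j) k (w j)) i ⟩
    apply (λ j → - k * w j + apply w j) i     ≈⟨ apply-linear (- k) w (apply w) i ⟩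
    - k * apply w i + apply (apply w) i       ≈⟨ solve 3 (λ k x y → (:- k) :* x :+ y := y :- k :* x) refl k (apply w i) (apply (apply w) i) ⟩
    shift k (apply w) i                       ∎

  -- Both sides expand to A² w - (k + l) A w + k l w.
  shift-comm : ∀ k l w → shift k (shift l w) ≋ shift l (shift k w)
  shift-comm k l w i = begin
    apply (shift l w) i - k * shift l w i   ≈⟨ +-congʳ (apply-shift l w i) ⟩
    apply (apply w) i - l * apply w i - k * (apply w i - l * w i)
      ≈⟨ solve 5 (λ k l x y w → y :- l :* x :- k :* (x :- l :* w) := y :- k :* x :- l :* (x :- k :* w)) refl k l (apply w i) (apply (apply w) i) (w i) ⟩
    apply (apply w) i - k * apply w i - l * (apply w i - k * w i)
      ≈⟨ +-congʳ (apply-shift k w i) ⟨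
    apply (shift k w) i - l * shift k w i ∎

  shifts-cong : ∀ ks {v w} → v ≋ w → shifts ks v ≋ shifts ks w
  shifts-cong []       v≋w = v≋w
  shifts-cong (k ∷ ks) v≋w = shifts-cong ks (shift-cong k v≋w)

  shifts-shift : ∀ ks k w → shifts ks (shift k w) ≋ shift k (shifts ks w)
  shifts-shift []       k w i = refl
  shifts-shift (l ∷ ks) k w i = trans (shifts-cong ks (shift-comm l k w) i) (shifts-shift ks k (shift l w) i)

  -- act p w is p(A) w, with the same convention on p as in evaluate.
  act : ∀ {d} → Vec Carrier d → Vector Carrier n → Vector Carrier n
  act []      w = w
  act (c ∷ p) w i = c * w i + act p (apply w) i

  act-cong : ∀ {d} (p : Vec Carrier d) {v w} → v ≋ w → act p v ≋ act p w
  act-cong []      v≋w i = v≋w i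
  act-cong (c ∷ p) v≋w i = +-cong (*-congˡ (v≋w i)) (act-cong p (apply-cong v≋w) i)

  act-shift : ∀ {d} (p : Vec Carrier d) k w → act p (shift k w) ≋ shift k (act p w)
  act-shift []      k w i = refl
  act-shift (c ∷ p) k w i = begin
    c * shift k w i + act p (apply (shift k w)) i  ≈⟨ +-congˡ (act-cong p (apply-shift k w) i) ⟩
    c * shift k w i + act p (shift k (apply w)) i  ≈⟨ +-congˡ (act-shift p k (apply w) i) ⟩
    c * shift k w i + shift k (act p (apply w)) i  ≈⟨ shift-linear k c w (act p (apply w)) i ⟨
    shift k (act (c ∷ p) w) i                      ∎

  -- Division with remainder, p = (x - μ) q + p(μ), evaluated at A. The induction follows Horner's
  -- scheme, one coefficient at a time.
  act-quotient : ∀ {d} μ c (p : Vec Carrier d) w i →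
                 act (c ∷ p) w i ≈ shift μ (act (quotient μ p) w) i + evaluate (c ∷ p) μ * w i
  act-quotient μ c []       w i = begin
    c * w i + apply w i
      ≈⟨ solve 4 (λ μ c x w → c :* w :+ x := (x :- μ :* w) :+ (c :+ μ) :* w) refl μ c (apply w i) (w i) ⟩
    shift μ w i + (c + μ) * w i
      ≈⟨ +-congˡ (*-congʳ (+-congˡ (*-identityʳ μ))) ⟨
    shift μ w i + (c + μ * 1#) * w i ∎
  act-quotient μ c (c′ ∷ p) w i = begin
    c * w i + act (c′ ∷ p) (apply w) i
      ≈⟨ +-congˡ (act-quotient μ c′ p (apply w) i) ⟩
    c * w i + (shift μ r i + e * apply w i)
      ≈⟨ solve 6 (λ c e μ w x s → c :* w :+ (s :+ e :* x) := e :* (x :- μ :* w) :+ s :+ (c :+ μ :* e) :* w)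
           refl c e μ (w i) (apply w i) (shift μ r i) ⟩
    e * shift μ w i + shift μ r i + (c + μ * e) * w i
      ≈⟨ +-congʳ (shift-linear μ e w r i) ⟨
    shift μ (act (quotient μ (c′ ∷ p)) w) i + (c + μ * e) * w i ∎
    where
    e = evaluate (c′ ∷ p) μ
    r = act (quotient μ p) (apply w)

  iterate : ℕ → Vector Carrier n → Vector Carrier n
  iterate zero    w = w
  iterate (suc k) w = iterate k (apply w)

  -- The negated coefficients encode x^m - Σ cₖ x^k, so a dependence of A^m w on the lower powers
  -- turns into a monic polynomial that annihilates w.
  act-combine : ∀ {m} (cs : Vec Carrier m) w i →
                act (Vec.map -_ cs) w i + combine cs (λ k → iterate k w i) ≈ iterate m w i
  act-combine []       w i = +-identityʳ (w i)
  act-combine (c ∷ cs) w i = trans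
    (solve 4 (λ c x y z → (:- c) :* x :+ y :+ (c :* x :+ z) := y :+ z) refl
      c (w i) (act (Vec.map -_ cs) (apply w) i) (combine cs (λ k → iterate k (apply w) i)))
    (act-combine cs (apply w) i)

-- Linear algebra over the algebraically closed field, under double negation.

module ClosedField {c ℓ₁ ℓ₂} (K : AlgebraicallyClosedField c ℓ₁ ℓ₂) where
  open AlgebraicallyClosedField K hiding (sum)
  open CommutativeRing commutativeRing using (+-abelianGroup)
  open SemiringSum semiring using (sum; sum-cong-≋; *-distribˡ-sum)
  open IntegerMultiples commutativeRing
  open LinearCombination commutativeRing
  open MonicPolynomial commutativeRing
  open import Relation.Binary.Reasoning.Setoid setoid

  ¬#⇒≈ : ∀ {x y} → ¬ x # y → x ≈ y
  ¬#⇒≈ {x} {y} = proj₁ (tight x y)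

  fromℤ≈⟦⟧ : ∀ k → fromℤ k ≈ ⟦ k ⟧
  fromℤ≈⟦⟧ (+ n)    = refl
  fromℤ≈⟦⟧ -[1+ n ] = refl

  -- Characteristic zero makes the integers embed, so that equations proved in the field can be read
  -- back over ℤ.
  ⟦⟧-injective-0 : ∀ k → ⟦ k ⟧ ≈ 0# → k ≡ 0ℤ
  ⟦⟧-injective-0 (+ zero)  _  = ≡.refl
  ⟦⟧-injective-0 (+ suc n) eq = contradiction eq (characteristicZero n)
  ⟦⟧-injective-0 -[1+ n ]  eq = contradiction
    (trans (sym (⁻¹-involutive _)) (trans (-‿cong eq) ε⁻¹≈ε)) (characteristicZero n)
    where open AbelianGroupProperties +-abelianGroup using (⁻¹-involutive; ε⁻¹≈ε)

  -- Apartness need not be decidable, but it is tight: refuting the first alternative at every index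
  -- already yields the second.
  some-apart⊎all-zero : ∀ {n} (v : Vector Carrier n) → ¬ ¬ ((∃[ i ] v i # 0#) ⊎ (∀ i → v i ≈ 0#))
  some-apart⊎all-zero v ¬either = ¬either (inj₂ λ i → ¬#⇒≈ λ vᵢ#0 → ¬either (inj₁ (i , vᵢ#0)))

  reciprocal : ∀ {x} → x # 0# → ∃[ y ] y * x ≈ 1#
  reciprocal {x} x#0 with #⇒invertible x#0
  ... | y , y*x , _ = y , trans (*-congˡ (sym (trans (+-congˡ ε⁻¹≈ε) (+-identityʳ x)))) y*x
    where open AbelianGroupProperties +-abelianGroup using (ε⁻¹≈ε)

  -- Gaussian elimination, by induction on the dimension. If `v 0` vanishes, it is the empty
  -- combination. Otherwise an invertible entry of `v 0` serves as pivot to clear one coordinate of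
  -- all later vectors, which then live in dimension n.
  dependence : ∀ {n} (v : ℕ → Vector Carrier n) →
               ¬ ¬ (∃[ m ] ∃[ cs ] ∀ i → v m i ≈ combine {m} cs (λ k → v k i))
  dependence {zero}  v none = none (0 , [] , λ ())
  dependence {suc n} v none = some-apart⊎all-zero (v 0) λ where
      (inj₂ v₀≈0)       → none (0 , [] , v₀≈0)
      (inj₁ (i , vᵢ#0)) → eliminate i (reciprocal vᵢ#0)
    where
    eliminate : ∀ i → (∃[ y ] y * v 0 i ≈ 1#) → _
    eliminate i (y , yv≈1) = dependence (λ k j → v′ k (punchIn i j)) λ (m , cs , dep) →
      -- Undoing the elimination adds `h m` copies of `v 0` on the left and takes away
      -- `combine cs h` copies on the right; their difference is the new coefficient.
      none (suc m , (h m - combine cs h) ∷ cs , λ j → lift m cs j (vanish m cs dep j))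
      where
      h : ℕ → Carrier
      h k = v (suc k) i * y
      v′ : ℕ → Vector Carrier (suc n)
      v′ k j = v (suc k) j - h k * v 0 j
      v′ᵢ≈0 : ∀ k → v′ k i ≈ 0#
      v′ᵢ≈0 k = begin
        v (suc k) i - v (suc k) i * y * v 0 i   ≈⟨ +-congˡ (-‿cong (trans (*-assoc _ _ _) (trans (*-congˡ yv≈1) (*-identityʳ _)))) ⟩
        v (suc k) i - v (suc k) i               ≈⟨ -‿inverseʳ _ ⟩
        0# ∎
      -- The induction hypothesis covers the coordinates other than i; at i all reduced vectors are
      -- zero.
      vanish : ∀ m cs → (∀ j → v′ m (punchIn i j) ≈ combine {m} cs (λ k → v′ k (punchIn i j))) →
               ∀ j → v′ m j ≈ combine {m} cs (λ k → v′ k j)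
      vanish m cs dep j with i Fin.≟ j
      ... | yes ≡.refl = trans (v′ᵢ≈0 m) (sym (combine-zero cs v′ᵢ≈0))
      ... | no  i≢j    = ≡.subst (λ j → v′ m j ≈ combine cs (λ k → v′ k j)) (Fin.punchIn-punchOut i≢j) (dep (punchOut i≢j))
      lift : ∀ m (cs : Vec Carrier m) j → v′ m j ≈ combine cs (λ k → v′ k j) →
             v (suc m) j ≈ (h m - combine cs h) * v 0 j + combine cs (λ k → v (suc k) j)
      lift m cs j eq = begin
        v (suc m) j
          ≈⟨ solve 2 (λ x y → x := (x :- y) :+ y) refl (v (suc m) j) (h m * v 0 j) ⟩
        v′ m j + h m * v 0 j
          ≈⟨ +-congʳ (trans eq (combine-linear cs (λ k → v (suc k) j) h (v 0 j))) ⟩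
        combine cs (λ k → v (suc k) j) - combine cs h * v 0 j + h m * v 0 j
          ≈⟨ solve 4 (λ x c a h → x :- c :* a :+ h :* a := (h :- c) :* a :+ x) refl
               (combine cs (λ k → v (suc k) j)) (combine cs h) (v 0 j) (h m) ⟩
        (h m - combine cs h) * v 0 j + combine cs (λ k → v (suc k) j) ∎

  -- Translates the nested Horner form into the sum of powers for which `hasRoot` supplies a root.
  evaluate-sum : ∀ {d} (p : Vec Carrier d) x → evaluate p x ≈ x ^ d + sum (λ i → Vec.lookup p i * x ^ toℕ i)
  evaluate-sum []      x = sym (+-identityʳ 1#)
  evaluate-sum {suc d} (c ∷ p) x = begin
    c + x * evaluate p x
      ≈⟨ +-congˡ (*-congˡ (evaluate-sum p x)) ⟩
    c + x * (x ^ d + sum (λ i → Vec.lookup p i * x ^ toℕ i))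
      ≈⟨ solve 4 (λ c x y z → c :+ x :* (y :+ z) := x :* y :+ (c :+ x :* z)) refl c x (x ^ d) (sum (λ i → Vec.lookup p i * x ^ toℕ i)) ⟩
    x * x ^ d + (c + x * sum (λ i → Vec.lookup p i * x ^ toℕ i))
      ≈⟨ +-congˡ (+-cong (sym (*-identityʳ c)) (*-distribˡ-sum x (λ i → Vec.lookup p i * x ^ toℕ i))) ⟩
    x * x ^ d + (c * 1# + sum (λ i → x * (Vec.lookup p i * x ^ toℕ i)))
      ≈⟨ +-congˡ (+-congˡ (sum-cong-≋ (λ i → solve 3 (λ x y z → x :* (y :* z) := y :* (x :* z)) refl x (Vec.lookup p i) (x ^ toℕ i)))) ⟩
    x * x ^ d + (c * 1# + sum (λ i → Vec.lookup p i * (x * x ^ toℕ i))) ∎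

  root : ∀ {d} (p : Vec Carrier (suc d)) → ∃[ μ ] evaluate p μ ≈ 0#
  root p with hasRoot (Vec.lookup p)
  ... | μ , eq = μ , trans (evaluate-sum p μ) eq

  module _ {n : ℕ} (A : Fin n → Fin n → Carrier) where
    open MatrixAction commutativeRing A

    -- The vectors w, A w, A² w, ... are linearly dependent. Since the dependence expresses one of
    -- them through its predecessors, the resulting polynomial is monic.
    annihilator : ∀ w → ¬ ¬ (∃[ m ] ∃[ p ] ∀ i → act {m} p w i ≈ 0#)
    annihilator w none = dependence (λ k → iterate k w) λ (m , cs , dep) → none (m , Vec.map -_ cs , λ i → begin
      act (Vec.map -_ cs) w i
        ≈⟨ solve 2 (λ x y → x := (x :+ y) :- y) refl (act (Vec.map -_ cs) w i) (combine cs (λ k → iterate k w i)) ⟩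
      act (Vec.map -_ cs) w i + combine cs (λ k → iterate k w i) - combine cs (λ k → iterate k w i)
        ≈⟨ +-cong (act-combine cs w i) (-‿cong (sym (dep i))) ⟩
      iterate m w i - iterate m w i
        ≈⟨ -‿inverseʳ _ ⟩
      0# ∎)

    module _ (integral : ∀ μ → IsEigenvalue K A μ → ∃[ k ] μ ≈ fromℤ k) where

      -- For a root μ of p, either p / (x − μ) already annihilates w, or it maps
      -- w to an eigenvector, so that μ is an integer and p / (x − μ) annihilates
      -- shift μ w.
      act⇒shifts : ∀ {d} (p : Vec Carrier d) w → (∀ i → act p w i ≈ 0#) →
                   ¬ ¬ (∃[ ks ] ∀ i → shifts (List.map ⟦_⟧ ks) w i ≈ 0#)
      act⇒shifts []      w w≈0 none = none ([] , w≈0)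
      act⇒shifts {suc d} (c ∷ p) w pw≈0 none with root (c ∷ p)
      ... | μ , p[μ]≈0 = some-apart⊎all-zero v λ where
          (inj₂ v≈0) → act⇒shifts q w v≈0 none
          (inj₁ v#0) → let k , μ≈k = integral μ (v , v#0 , eigen)
                           μ≈⟦k⟧ = trans μ≈k (fromℤ≈⟦⟧ k) in
            act⇒shifts q (shift ⟦ k ⟧ w)
              (λ i → trans (act-shift q ⟦ k ⟧ w i) (trans (sym (shift-congˡ μ≈⟦k⟧ v i)) (shift≈0 i)))
              λ (ks , eq) → none (k ∷ ks , eq)
        where
        q = quotient μ p
        v = act q w
        shift≈0 : ∀ i → shift μ v i ≈ 0#
        shift≈0 i = begin
          shift μ v i                               ≈⟨ +-identityʳ _ ⟨
          shift μ v i + 0#                          ≈⟨ +-congˡ (zeroˡ (w i)) ⟨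
          shift μ v i + 0# * w i                    ≈⟨ +-congˡ (*-congʳ p[μ]≈0) ⟨
          shift μ v i + evaluate (c ∷ p) μ * w i    ≈⟨ act-quotient μ c p w i ⟨
          act (c ∷ p) w i                           ≈⟨ pw≈0 i ⟩
          0#                                        ∎
        eigen : ∀ i → apply v i ≈ μ * v i
        eigen i = AbelianGroupProperties.x∙y⁻¹≈ε⇒x≈y +-abelianGroup _ _ (shift≈0 i)

      shifts-annihilate : ∀ w → ¬ ¬ (∃[ ks ] ∀ i → shifts (List.map ⟦_⟧ ks) w i ≈ 0#)
      shifts-annihilate w none = annihilator w λ (m , p , pw≈0) → act⇒shifts p w pw≈0 none

-- Transfer of shifts between an integer matrix and its image in the ring.

module Reduction {c ℓ} (R : CommutativeRing c ℓ) {n : ℕ} (A : Fin n → Fin n → CommutativeRing.Carrier R) (B : Fin n → Fin n → ℤ) where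
  open CommutativeRing R hiding (zero)
  open IntegerMultiples R
  open SemiringSum semiring using (sum; sum-cong-≋)
  open SemiringSum ℤ.+-*-semiring using () renaming (sum to ∑)
  open MatrixAction R A
  module ℤᴬ = MatrixAction ℤ.+-*-commutativeRing B

  ⟦⟧-homo-sum : ∀ {m} (f : Vector ℤ m) → ⟦ ∑ f ⟧ ≈ sum (⟦_⟧ ∘ f)
  ⟦⟧-homo-sum {zero}  f = refl
  ⟦⟧-homo-sum {suc m} f = trans (⟦⟧-homo-+ (f zero) (∑ (f ∘ suc))) (+-congˡ (⟦⟧-homo-sum (f ∘ suc)))

  module _ (⟦B⟧≈A : ∀ i j → ⟦ B i j ⟧ ≈ A i j) where

    ⟦⟧-homo-shift : ∀ k w → (⟦_⟧ ∘ ℤᴬ.shift k w) ≋ shift ⟦ k ⟧ (⟦_⟧ ∘ w)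
    ⟦⟧-homo-shift k w i = trans (⟦⟧-homo-+ (ℤᴬ.apply w i) (ℤ.- (k ℤ.* w i)))
      (+-cong
        (trans (⟦⟧-homo-sum (λ j → B i j ℤ.* w j))
               (sum-cong-≋ (λ j → trans (⟦⟧-homo-* (B i j) (w j)) (*-congʳ (⟦B⟧≈A i j)))))
        (trans (⟦⟧-homo-neg (k ℤ.* w i)) (-‿cong (⟦⟧-homo-* k (w i)))))

    ⟦⟧-homo-shifts : ∀ ks w → (⟦_⟧ ∘ ℤᴬ.shifts ks w) ≋ shifts (List.map ⟦_⟧ ks) (⟦_⟧ ∘ w)
    ⟦⟧-homo-shifts []       w i = refl
    ⟦⟧-homo-shifts (k ∷ ks) w i = trans (⟦⟧-homo-shifts ks (ℤᴬ.shift k w) i)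
      (shifts-cong (List.map ⟦_⟧ ks) (⟦⟧-homo-shift k w) i)

-- Finite sums of integers and indicator values.

open SemiringSum ℤ.+-*-semiring using (sum; sum-cong-≗; sum-replicate-zero; ∑-comm; ∑-distrib-+; *-distribˡ-sum; *-distribʳ-sum)

𝟙 : Bool → ℤ
𝟙 b = if b then 1ℤ else 0ℤ

𝟙-nonNeg : ∀ b → 0ℤ ℤ.≤ 𝟙 b
𝟙-nonNeg true  = ℤ.+≤+ ℕ.z≤n
𝟙-nonNeg false = ℤ.≤-refl

𝟙-yes : ∀ {p} {P : Set p} (P? : Dec P) → P → 𝟙 (does P?) ≡ 1ℤ
𝟙-yes P? p = ≡.cong 𝟙 (dec-true P? p)

𝟙-no : ∀ {p} {P : Set p} (P? : Dec P) → ¬ P → 𝟙 (does P?) ≡ 0ℤ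
𝟙-no P? ¬p = ≡.cong 𝟙 (dec-false P? ¬p)

sum-mono : ∀ {n} {f g : Vector ℤ n} → (∀ i → f i ℤ.≤ g i) → sum f ℤ.≤ sum g
sum-mono {zero}  f≤g = ℤ.≤-refl
sum-mono {suc n} f≤g = ℤ.+-mono-≤ (f≤g zero) (sum-mono (f≤g ∘ suc))

sum-nonNeg : ∀ {n} {f : Vector ℤ n} → (∀ i → 0ℤ ℤ.≤ f i) → 0ℤ ℤ.≤ sum f
sum-nonNeg {zero}  0≤f = ℤ.≤-refl
sum-nonNeg {suc n} 0≤f = ℤ.+-mono-≤ (0≤f zero) (sum-nonNeg (0≤f ∘ suc))

term≤sum : ∀ {n} {f : Vector ℤ n} → (∀ i → 0ℤ ℤ.≤ f i) → ∀ i → f i ℤ.≤ sum f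
term≤sum {f = f} 0≤f zero    = ≡.subst (ℤ._≤ sum f) (ℤ.+-identityʳ (f zero)) (ℤ.+-monoʳ-≤ (f zero) (sum-nonNeg (0≤f ∘ suc)))
term≤sum {f = f} 0≤f (suc i) = ≡.subst (ℤ._≤ sum f) (ℤ.+-identityˡ (f (suc i))) (ℤ.+-mono-≤ (0≤f zero) (term≤sum (0≤f ∘ suc) i))

∣sum∣≤sum∣∣ : ∀ {n} (f : Vector ℤ n) → + ∣ sum f ∣ ℤ.≤ sum (λ i → + ∣ f i ∣)
∣sum∣≤sum∣∣ {zero}  f = ℤ.≤-refl
∣sum∣≤sum∣∣ {suc n} f = ℤ.≤-trans (ℤ.+≤+ (ℤ.∣i+j∣≤∣i∣+∣j∣ (f zero) (sum (f ∘ suc)))) (ℤ.+-monoʳ-≤ (+ ∣ f zero ∣) (∣sum∣≤sum∣∣ (f ∘ suc)))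

sum-zero : ∀ {n} {f : Vector ℤ n} → (∀ i → f i ≡ 0ℤ) → sum f ≡ 0ℤ
sum-zero {n} f≡0 = ≡.trans (sum-cong-≗ f≡0) (sum-replicate-zero n)

sum-𝟙≟ : ∀ {n} (i : Fin n) (f : Vector ℤ n) → sum (λ j → 𝟙 (does (j Fin.≟ i)) ℤ.* f j) ≡ f i
sum-𝟙≟ zero f = ≡.trans (≡.cong₂ ℤ._+_ (ℤ.*-identityˡ (f zero)) (sum-zero λ j → ℤ.*-zeroˡ (f (suc j)))) (ℤ.+-identityʳ (f zero))
sum-𝟙≟ (suc i) f = ≡.trans (≡.cong₂ ℤ._+_ (ℤ.*-zeroˡ (f zero)) (sum-𝟙≟ i (f ∘ suc))) (ℤ.+-identityˡ (f (suc i)))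

i*i-nonNeg : ∀ i → 0ℤ ℤ.≤ i ℤ.* i
i*i-nonNeg (+ n)    = ≡.subst (0ℤ ℤ.≤_) (ℤ.pos-* n n) (ℤ.+≤+ ℕ.z≤n)
i*i-nonNeg -[1+ n ] = ℤ.+≤+ ℕ.z≤n

i*i-pos : ∀ {i} → i ≢ 0ℤ → 0ℤ ℤ.< i ℤ.* i
i*i-pos {+ zero}   i≢0 = contradiction ≡.refl i≢0
i*i-pos {+ suc n}  i≢0 = ℤ.+<+ ℕ.z<s
i*i-pos { -[1+ n ]} i≢0 = ℤ.+<+ ℕ.z<s

-- Symmetric integer matrices and their inner product.

module SymmetricIntegerMatrix {n : ℕ} (A : Fin n → Fin n → ℤ) (A-sym : ∀ i j → A i j ≡ A j i) where
  open MatrixAction ℤ.+-*-commutativeRing A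
  open ≡.≡-Reasoning

  ⟨_,_⟩ : Vector ℤ n → Vector ℤ n → ℤ
  ⟨ u , v ⟩ = sum (λ i → u i ℤ.* v i)

  -- A single nonzero entry would already make the sum of squares positive.
  definite : ∀ v → ⟨ v , v ⟩ ≡ 0ℤ → ∀ i → v i ≡ 0ℤ
  definite v vv≡0 i with v i ℤ.≟ 0ℤ
  ... | yes vᵢ≡0 = vᵢ≡0
  ... | no  vᵢ≢0 = contradiction (ℤ.<-≤-trans (i*i-pos vᵢ≢0) (term≤sum (λ j → i*i-nonNeg (v j)) i)) (ℤ.<-irrefl (≡.sym vv≡0))

  apply-selfAdjoint : ∀ u v → ⟨ apply u , v ⟩ ≡ ⟨ u , apply v ⟩
  apply-selfAdjoint u v = begin
    sum (λ i → apply u i ℤ.* v i)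
      ≡⟨ sum-cong-≗ (λ i → *-distribʳ-sum (v i) (λ j → A i j ℤ.* u j)) ⟩
    sum (λ i → sum (λ j → A i j ℤ.* u j ℤ.* v i))
      ≡⟨ ∑-comm (λ i j → A i j ℤ.* u j ℤ.* v i) ⟩
    sum (λ j → sum (λ i → A i j ℤ.* u j ℤ.* v i))
      ≡⟨ sum-cong-≗ (λ j → sum-cong-≗ λ i → ≡.trans (rearrange (A i j) (u j) (v i)) (≡.cong (λ a → u j ℤ.* (a ℤ.* v i)) (A-sym i j))) ⟩
    sum (λ j → sum (λ i → u j ℤ.* (A j i ℤ.* v i)))
      ≡⟨ sum-cong-≗ (λ j → *-distribˡ-sum (u j) (λ i → A j i ℤ.* v i)) ⟨
    sum (λ j → u j ℤ.* apply v j) ∎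
    where
    rearrange : ∀ a u v → a ℤ.* u ℤ.* v ≡ u ℤ.* (a ℤ.* v)
    rearrange = solve-∀

  shift-selfAdjoint : ∀ k u v → ⟨ shift k u , v ⟩ ≡ ⟨ u , shift k v ⟩
  shift-selfAdjoint k u v = begin
    sum (λ i → shift k u i ℤ.* v i)
      ≡⟨ sum-cong-≗ (λ i → expandˡ (apply u i) k (u i) (v i)) ⟩
    sum (λ i → apply u i ℤ.* v i ℤ.+ ℤ.- k ℤ.* (u i ℤ.* v i))
      ≡⟨ ∑-distrib-+ (λ i → apply u i ℤ.* v i) (λ i → ℤ.- k ℤ.* (u i ℤ.* v i)) ⟩
    ⟨ apply u , v ⟩ ℤ.+ sum (λ i → ℤ.- k ℤ.* (u i ℤ.* v i))
      ≡⟨ ≡.cong (ℤ._+ sum (λ i → ℤ.- k ℤ.* (u i ℤ.* v i))) (apply-selfAdjoint u v) ⟩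
    ⟨ u , apply v ⟩ ℤ.+ sum (λ i → ℤ.- k ℤ.* (u i ℤ.* v i))
      ≡⟨ ∑-distrib-+ (λ i → u i ℤ.* apply v i) (λ i → ℤ.- k ℤ.* (u i ℤ.* v i)) ⟨
    sum (λ i → u i ℤ.* apply v i ℤ.+ ℤ.- k ℤ.* (u i ℤ.* v i))
      ≡⟨ sum-cong-≗ (λ i → expandʳ (apply v i) k (u i) (v i)) ⟨
    sum (λ i → u i ℤ.* shift k v i) ∎
    where
    expandˡ : ∀ x k u v → (x ℤ.- k ℤ.* u) ℤ.* v ≡ x ℤ.* v ℤ.+ ℤ.- k ℤ.* (u ℤ.* v)
    expandˡ = solve-∀
    expandʳ : ∀ x k u v → u ℤ.* (x ℤ.- k ℤ.* v) ≡ u ℤ.* x ℤ.+ ℤ.- k ℤ.* (u ℤ.* v)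
    expandʳ = solve-∀

  shifts-selfAdjoint : ∀ ks u v → ⟨ shifts ks u , v ⟩ ≡ ⟨ u , shifts ks v ⟩
  shifts-selfAdjoint []       u v = ≡.refl
  shifts-selfAdjoint (k ∷ ks) u v = begin
    ⟨ shifts ks (shift k u) , v ⟩ ≡⟨ shifts-selfAdjoint ks (shift k u) v ⟩
    ⟨ shift k u , shifts ks v ⟩   ≡⟨ shift-selfAdjoint k u (shifts ks v) ⟩
    ⟨ u , shift k (shifts ks v) ⟩ ≡⟨ sum-cong-≗ (λ i → ≡.cong (u i ℤ.*_) (shifts-shift ks k v i)) ⟨
    ⟨ u , shifts ks (shift k v) ⟩ ∎

  shift-zero : ∀ k {w} → (∀ i → w i ≡ 0ℤ) → ∀ i → shift k w i ≡ 0ℤ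
  shift-zero k {w} w≡0 i = ≡.cong₂ (λ x y → x ℤ.- y)
    (sum-zero (λ j → ≡.trans (≡.cong (A i j ℤ.*_) (w≡0 j)) (ℤ.*-zeroʳ (A i j))))
    (≡.trans (≡.cong (k ℤ.*_) (w≡0 i)) (ℤ.*-zeroʳ k))

  shifts-zero : ∀ ks {w} → (∀ i → w i ≡ 0ℤ) → ∀ i → shifts ks w i ≡ 0ℤ
  shifts-zero []       w≡0 = w≡0
  shifts-zero (k ∷ ks) w≡0 = shifts-zero ks (shift-zero k w≡0)

  -- The factor A - k can be moved past the other factors until it meets `y`, which it annihilates.
  shifts-eigenvector : ∀ {ks k} → k ∈ ks → ∀ {y} → (∀ i → shift k y i ≡ 0ℤ) → ∀ i → shifts ks y i ≡ 0ℤ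
  shifts-eigenvector {_ ∷ ks}     (here ≡.refl)  eq = shifts-zero ks eq
  shifts-eigenvector {l ∷ ks} {k} (there k∈ks) {y} eq =
    shifts-eigenvector k∈ks (λ i → ≡.trans (shift-comm k l y i) (shift-zero l eq i))

  -- If (A − k) p(A) u = 0 for y = p(A) u ≠ 0, then k is a root of p, so that
  -- ⟨ y , y ⟩ = ⟨ u , p(A) y ⟩ = 0.
  shifts-spectrum : ∀ spectrum → (∀ k y → (∀ i → shift k y i ≡ 0ℤ) → (∃[ i ] y i ≢ 0ℤ) → k ∈ spectrum) →
                    ∀ ks u → (∀ i → shifts ks u i ≡ 0ℤ) → ∀ i → shifts spectrum u i ≡ 0ℤ
  shifts-spectrum spectrum complete []       u u≡0 = shifts-zero spectrum u≡0
  shifts-spectrum spectrum complete (k ∷ ks) u eq i with shifts spectrum u i ℤ.≟ 0ℤ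
  ... | yes yᵢ≡0 = yᵢ≡0
  ... | no  yᵢ≢0 = definite y yy≡0 i
    where
    y = shifts spectrum u
    eigen : ∀ i → shift k y i ≡ 0ℤ
    -- The induction hypothesis for `shift k u` says that p(A) (A - k) u = 0, and the factors
    -- commute.
    eigen i = ≡.trans (≡.sym (shifts-shift spectrum k u i)) (shifts-spectrum spectrum complete ks (shift k u) eq i)
    yy≡0 : ⟨ y , y ⟩ ≡ 0ℤ
    yy≡0 = ≡.trans (shifts-selfAdjoint spectrum u y) (sum-zero λ j →
      ≡.trans (≡.cong (u j ℤ.*_) (shifts-eigenvector (complete k y eigen (i , yᵢ≢0)) eigen j)) (ℤ.*-zeroʳ (u j)))

-- Bounds for the integer eigenvalues of a Gram matrix.

module Gram {m n : ℕ} (N : Fin m → Fin n → ℤ) where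

  image : Vector ℤ n → Vector ℤ m
  image y x = sum (λ e → N x e ℤ.* y e)

  -- The matrix Nᵀ N as an operator, with no product matrix formed.
  gram : Vector ℤ n → Vector ℤ n
  gram y e = sum (λ x → N x e ℤ.* image y x)

  -- Adjointness of N and Nᵀ: exchanging the two sums moves Nᵀ to the other side of the inner
  -- product.
  pairing : ∀ z y → sum (λ e → z e ℤ.* gram y e) ≡ sum (λ x → image z x ℤ.* image y x)
  pairing z y = begin
    sum (λ e → z e ℤ.* gram y e)
      ≡⟨ sum-cong-≗ (λ e → *-distribˡ-sum (z e) (λ x → N x e ℤ.* image y x)) ⟩
    sum (λ e → sum (λ x → z e ℤ.* (N x e ℤ.* image y x)))
      ≡⟨ ∑-comm (λ e x → z e ℤ.* (N x e ℤ.* image y x)) ⟩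
    sum (λ x → sum (λ e → z e ℤ.* (N x e ℤ.* image y x)))
      ≡⟨ sum-cong-≗ (λ x → sum-cong-≗ (λ e → rearrange (z e) (N x e) (image y x))) ⟩
    sum (λ x → sum (λ e → N x e ℤ.* z e ℤ.* image y x))
      ≡⟨ sum-cong-≗ (λ x → *-distribʳ-sum (image y x) (λ e → N x e ℤ.* z e)) ⟨
    sum (λ x → image z x ℤ.* image y x) ∎
    where
    open ≡.≡-Reasoning
    rearrange : ∀ a b c → a ℤ.* (b ℤ.* c) ≡ b ℤ.* a ℤ.* c
    rearrange = solve-∀

  module _ {θ : ℤ} {y : Vector ℤ n} (eigen : ∀ e → gram y e ≡ θ ℤ.* y e) (y≢0 : ∃[ e ] y e ≢ 0ℤ) where

    -- The eigenvalue equation gives θ ⟨ y , y ⟩ = ⟨ N y , N y ⟩, a sum of squares, and the positive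
    -- factor ⟨ y , y ⟩ can be cancelled.
    eigenvalue-nonNeg : 0ℤ ℤ.≤ θ
    eigenvalue-nonNeg = ℤ.*-cancelʳ-≤-pos 0ℤ θ (sum (λ e → y e ℤ.* y e)) {{ℤ.positive yy>0}}
      (≡.subst₂ ℤ._≤_ (≡.sym (ℤ.*-zeroˡ (sum (λ e → y e ℤ.* y e)))) image²≡θyy (sum-nonNeg (λ x → i*i-nonNeg (image y x))))
      where
      open ≡.≡-Reasoning
      yy>0 : 0ℤ ℤ.< sum (λ e → y e ℤ.* y e)
      yy>0 = ℤ.<-≤-trans (i*i-pos (proj₂ y≢0)) (term≤sum (λ e → i*i-nonNeg (y e)) (proj₁ y≢0))
      rearrange : ∀ y θ → y ℤ.* (θ ℤ.* y) ≡ θ ℤ.* (y ℤ.* y)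
      rearrange = solve-∀
      image²≡θyy : sum (λ x → image y x ℤ.* image y x) ≡ θ ℤ.* sum (λ e → y e ℤ.* y e)
      image²≡θyy = begin
        sum (λ x → image y x ℤ.* image y x)    ≡⟨ pairing y y ⟨
        sum (λ e → y e ℤ.* gram y e)           ≡⟨ sum-cong-≗ (λ e → ≡.cong (y e ℤ.*_) (eigen e)) ⟩
        sum (λ e → y e ℤ.* (θ ℤ.* y e))        ≡⟨ sum-cong-≗ (λ e → rearrange (y e) θ) ⟩
        sum (λ e → θ ℤ.* (y e ℤ.* y e))        ≡⟨ *-distribˡ-sum θ (λ e → y e ℤ.* y e) ⟨
        θ ℤ.* sum (λ e → y e ℤ.* y e)          ∎

    -- The ℓ¹-norm of N z is at most the largest column sum times that of z, and
    -- the ℓ¹-norm of Nᵀ z at most the largest row sum times that of z.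
    eigenvalue-≤ : (∀ x e → 0ℤ ℤ.≤ N x e) →
                   ∀ r → (∀ x → sum (N x) ℤ.≤ + r) →
                   ∀ c → (∀ e → sum (λ x → N x e) ℤ.≤ + c) →
                   θ ℤ.≤ + r ℤ.* + c
    eigenvalue-≤ N≥0 r row c column = ℤ.*-cancelʳ-≤-pos θ (+ r ℤ.* + c) (sum z) {{ℤ.positive z>0}} (begin
      θ ℤ.* sum z                                          ≡⟨ *-distribˡ-sum θ z ⟩
      sum (λ e → θ ℤ.* z e)                                ≤⟨ sum-mono θz≤gram ⟩
      sum (λ e → gram z e)                                 ≡⟨ ∑-comm (λ e x → N x e ℤ.* image z x) ⟩
      sum (λ x → sum (λ e → N x e ℤ.* image z x))          ≡⟨ sum-cong-≗ (λ x → *-distribʳ-sum (image z x) (N x)) ⟨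
      sum (λ x → sum (N x) ℤ.* image z x)                  ≤⟨ sum-mono (λ x → *-monoˡ (image≥0 x) (row x)) ⟩
      sum (λ x → + r ℤ.* image z x)                        ≡⟨ *-distribˡ-sum (+ r) (image z) ⟨
      + r ℤ.* sum (image z)                                ≡⟨ ≡.cong (+ r ℤ.*_) (∑-comm (λ x e → N x e ℤ.* z e)) ⟩
      + r ℤ.* sum (λ e → sum (λ x → N x e ℤ.* z e))        ≡⟨ ≡.cong (+ r ℤ.*_) (sum-cong-≗ (λ e → *-distribʳ-sum (z e) (λ x → N x e))) ⟨
      + r ℤ.* sum (λ e → sum (λ x → N x e) ℤ.* z e)        ≤⟨ ℤ.*-monoˡ-≤-nonNeg (+ r) (sum-mono (λ e → *-monoˡ (ℤ.+≤+ ℕ.z≤n) (column e))) ⟩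
      + r ℤ.* sum (λ e → + c ℤ.* z e)                      ≡⟨ ≡.cong (+ r ℤ.*_) (*-distribˡ-sum (+ c) z) ⟨
      + r ℤ.* (+ c ℤ.* sum z)                              ≡⟨ ℤ.*-assoc (+ r) (+ c) (sum z) ⟨
      + r ℤ.* + c ℤ.* sum z                                ∎)
      where
      open ℤ.≤-Reasoning
      z : Vector ℤ n
      z e = + ∣ y e ∣
      z>0 : 0ℤ ℤ.< sum z
      z>0 = ℤ.<-≤-trans (ℤ.+<+ (ℕ.>-nonZero⁻¹ _ {{ℕ.≢-nonZero (proj₂ y≢0 ∘ ℤ.∣i∣≡0⇒i≡0)}})) (term≤sum {f = z} (λ e → ℤ.+≤+ ℕ.z≤n) (proj₁ y≢0))
      *-monoˡ : ∀ {i j k} → 0ℤ ℤ.≤ k → i ℤ.≤ j → i ℤ.* k ℤ.≤ j ℤ.* k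
      *-monoˡ {k = k} 0≤k i≤j = ℤ.*-monoʳ-≤-nonNeg k {{ℤ.nonNegative 0≤k}} i≤j
      N-abs : ∀ x e i → + ∣ N x e ℤ.* i ∣ ≡ N x e ℤ.* + ∣ i ∣
      N-abs x e i = ≡.trans (≡.cong +_ (ℤ.abs-* (N x e) i)) (≡.trans (ℤ.pos-* ∣ N x e ∣ ∣ i ∣) (≡.cong (ℤ._* + ∣ i ∣) (ℤ.0≤i⇒+∣i∣≡i (N≥0 x e))))
      image≥0 : ∀ x → 0ℤ ℤ.≤ image z x
      image≥0 x = sum-nonNeg (λ e → ≡.subst (0ℤ ℤ.≤_) (N-abs x e (y e)) (ℤ.+≤+ ℕ.z≤n))
      ∣image∣≤ : ∀ x → + ∣ image y x ∣ ℤ.≤ image z x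
      ∣image∣≤ x = ≡.subst (+ ∣ image y x ∣ ℤ.≤_) (sum-cong-≗ (λ e → N-abs x e (y e))) (∣sum∣≤sum∣∣ (λ e → N x e ℤ.* y e))
      i≤∣i∣ : ∀ i → i ℤ.≤ + ∣ i ∣
      i≤∣i∣ (+ _)    = ℤ.≤-refl
      i≤∣i∣ -[1+ _ ] = ℤ.-≤+
      -- With N nonnegative, the triangle inequality applied to both sums bounds the absolute value
      -- of Nᵀ N y entrywise by Nᵀ N applied to the absolute values of `y`.
      θz≤gram : ∀ e → θ ℤ.* z e ℤ.≤ gram z e
      θz≤gram e = begin
        θ ℤ.* + ∣ y e ∣                                  ≤⟨ *-monoˡ (ℤ.+≤+ ℕ.z≤n) (i≤∣i∣ θ) ⟩
        + ∣ θ ∣ ℤ.* + ∣ y e ∣                            ≡⟨ ℤ.pos-* ∣ θ ∣ ∣ y e ∣ ⟨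
        + (∣ θ ∣ ℕ.* ∣ y e ∣)                            ≡⟨ ≡.cong +_ (ℤ.abs-* θ (y e)) ⟨
        + ∣ θ ℤ.* y e ∣                                  ≡⟨ ≡.cong (λ i → + ∣ i ∣) (eigen e) ⟨
        + ∣ gram y e ∣                                   ≤⟨ ∣sum∣≤sum∣∣ (λ x → N x e ℤ.* image y x) ⟩
        sum (λ x → + ∣ N x e ℤ.* image y x ∣)            ≡⟨ sum-cong-≗ (λ x → N-abs x e (image y x)) ⟩
        sum (λ x → N x e ℤ.* + ∣ image y x ∣)            ≤⟨ sum-mono (λ x → ℤ.*-monoˡ-≤-nonNeg (N x e) {{ℤ.nonNegative (N≥0 x e)}} (∣image∣≤ x)) ⟩
        gram z e                                         ∎

-- Extremal witnesses, the diameter and the clique number.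

least : ∀ {p} {P : ℕ → Set p} → Decidable P → ∀ {k} → P k → ∃[ d ] P d × (∀ j → P j → d ℕ.≤ j)
least P? {zero}  pk = 0 , pk , λ _ _ → ℕ.z≤n
least {P = P} P? {suc k} pk with P? 0
... | yes p₀ = 0 , p₀ , λ _ _ → ℕ.z≤n
... | no ¬p₀ with least (P? ∘ suc) pk
...   | d , pd , d-min = suc d , pd , min
  where
  min : ∀ j → P j → suc d ℕ.≤ j
  min zero    p₀ = contradiction p₀ ¬p₀
  min (suc j) pj = ℕ.s≤s (d-min j pj)

greatest : ∀ {p} {P : ℕ → Set p} → Decidable P → P 0 → ∀ b → (∀ j → P j → j ℕ.≤ b) →
           ∃[ m ] P m × (∀ j → P j → j ℕ.≤ m)
greatest P? p₀ zero bound = 0 , p₀ , bound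
greatest P? p₀ (suc b) bound with P? (suc b)
... | yes pb = suc b , pb , bound
... | no ¬pb = greatest P? p₀ b λ j pj → ℕ.≤-pred (ℕ.≤∧≢⇒< (bound j pj) λ { ≡.refl → ¬pb pj })

argmax : ∀ {n} → Fin n → (f : Fin n → ℕ) → ∃[ i ] (∀ j → f j ℕ.≤ f i)
argmax {suc zero} _ f = zero , λ { zero → ℕ.≤-refl }
argmax {suc (suc n)} _ f with argmax zero (f ∘ suc)
... | i , i-max with ℕ.≤-total (f zero) (f (suc i))
...   | inj₁ ≤ = suc i , λ { zero → ≤ ; (suc j) → i-max j }
...   | inj₂ ≥ = zero , λ { zero → ℕ.≤-refl ; (suc j) → ℕ.≤-trans (i-max j) ≥ }

module _ (G : Graph) where
  open Graph G

  walk? : ∀ u v → Decidable (Walk G u v)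
  walk? u v zero    = map′ (λ { ≡.refl → [] }) (λ { [] → ≡.refl }) (u Fin.≟ v)
  walk? u v (suc k) = map′ (λ (_ , u~w , W) → u~w ∷ W) (λ { (u~w ∷ W) → _ , u~w , W })
    (Fin.any? λ w → (u ~? w) ×-dec walk? w v k)

  -- Distances exist because walks of a given length are decidable. The diameter is the largest
  -- eccentricity, where `v₀` guarantees that both maxima range over a nonempty set.
  connected⇒diameter : Connected G → Vertex → ∃[ D ] IsDiameter G D
  connected⇒diameter connected v₀ = dist u v ,
    (λ x y → dist x y , dist-isDistance x y , ℕ.≤-trans (proj₂ (farthest x) y) (u-max x)) ,
    u , v , dist-isDistance u v
    where
    distance : ∀ x y → ∃[ d ] IsDistance G x y d
    distance x y = least (walk? x y) (proj₂ (connected x y))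
    dist : Vertex → Vertex → ℕ
    dist x y = proj₁ (distance x y)
    dist-isDistance : ∀ x y → IsDistance G x y (dist x y)
    dist-isDistance x y = proj₂ (distance x y)
    farthest : ∀ x → ∃[ y ] (∀ z → dist x z ℕ.≤ dist x y)
    farthest x = argmax v₀ (dist x)
    eccentric : ∃[ x ] (∀ z → dist z (proj₁ (farthest z)) ℕ.≤ dist x (proj₁ (farthest x)))
    eccentric = argmax v₀ (λ x → dist x (proj₁ (farthest x)))
    u = proj₁ eccentric
    u-max = proj₂ eccentric
    v = proj₁ (farthest u)

  isClique? : Decidable (IsClique G)
  isClique? S = map′ (λ c {u} {v} → c u v) (λ c u v → c {u} {v})
    (Fin.all? λ u → Fin.all? λ v → (u Subset.∈? S) →-dec ((v Subset.∈? S) →-dec (¬? (u Fin.≟ v) →-dec (u ~? v))))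

  cliqueNumber : ∃[ ω ] IsCliqueNumber G ω
  cliqueNumber with greatest
    (λ w → Subset.anySubset? (λ S → isClique? S ×-dec (Subset.∣ S ∣ ℕ.≟ w)))
    -- The empty clique witnesses size 0; the order of the graph bounds all sizes.
    (Subset.⊥ , (λ u∈⊥ → contradiction u∈⊥ Subset.∉⊥) , Subset.∣⊥∣≡0 order)
    order (λ { _ (S , _ , ≡.refl) → Subset.∣p∣≤n S })
  ... | ω , attained , ω-max = ω , attained , λ S clique → ω-max Subset.∣ S ∣ (S , clique , ≡.refl)

  adjacency : Vertex → Vertex → ℤ
  adjacency i j = 𝟙 (does (i ~? j))

  adjacency-sym : ∀ i j → adjacency i j ≡ adjacency j i
  adjacency-sym i j with i ~? j | j ~? i
  ... | yes _   | yes _   = ≡.refl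
  ... | no _    | no _    = ≡.refl
  ... | yes i~j | no ¬j~i = contradiction (~-sym i~j) ¬j~i
  ... | no ¬i~j | yes j~i = contradiction (~-sym j~i) ¬i~j

  -- Distance and polynomials in the adjacency matrix.

  open MatrixAction ℤ.+-*-commutativeRing adjacency

  -- The entries of a degree r monic polynomial in the adjacency matrix behave
  -- at distance at least r like those of its r-th power, which count walks.
  record Frontier (v : Vertex) (r : ℕ) (w : Vector ℤ order) : Set where
    field
      zero-beyond : ∀ x → (∀ k → k ℕ.≤ r → ¬ Walk G x v k) → w x ≡ 0ℤ
      positive-at : ∀ x → IsDistance G x v r → 0ℤ ℤ.< w x

  open Frontier

  -- Degree zero: the column of the identity matrix at `v`.
  frontier-𝟙 : ∀ v → Frontier v 0 (λ x → 𝟙 (does (x Fin.≟ v)))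
  frontier-𝟙 v .zero-beyond x no-walk with x Fin.≟ v
  ... | yes ≡.refl = contradiction [] (no-walk 0 ℕ.z≤n)
  ... | no  _      = ≡.refl
  frontier-𝟙 v .positive-at x ([] , _) rewrite dec-true (x Fin.≟ x) ≡.refl = ℤ.+<+ ℕ.z<s

  -- A neighbour of a vertex beyond r + 1 is beyond r. At distance r + 1 the term with k vanishes,
  -- no neighbour contributes negatively, and the next vertex of a shortest walk contributes
  -- positively.
  frontier-shift : ∀ {v r w} k → Frontier v r w → Frontier v (suc r) (shift k w)
  frontier-shift {v} {r} {w} k front .zero-beyond x no-walk = ≡.cong₂ (λ a b → a ℤ.- b)
    (sum-zero term≡0)
    (≡.trans (≡.cong (k ℤ.*_) (front .zero-beyond x λ j j≤r → no-walk j (ℕ.m≤n⇒m≤1+n j≤r))) (ℤ.*-zeroʳ k))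
    where
    term≡0 : ∀ j → adjacency x j ℤ.* w j ≡ 0ℤ
    term≡0 j with x ~? j
    ... | no  _   = ℤ.*-zeroˡ (w j)
    ... | yes x~j = ≡.trans (ℤ.*-identityˡ (w j))
                      (front .zero-beyond j λ k k≤r W → no-walk (suc k) (ℕ.s≤s k≤r) (x~j ∷ W))
  frontier-shift {v} {r} {w} k front .positive-at x (_∷_ {v = z} x~z W , 1+r-min) =
    ≡.subst (0ℤ ℤ.<_) (≡.sym shift≡apply) (ℤ.<-≤-trans term>0 (term≤sum term≥0 z))
    where
    farther : ∀ {j} → x ~ j → ∀ i → Walk G j v i → r ℕ.≤ i
    farther x~j i W′ = ℕ.≤-pred (1+r-min (suc i) (x~j ∷ W′))
    -- At distance r + 1 from `v`, the vertex `x` is still beyond the reach of `w`.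
    wx≡0 : w x ≡ 0ℤ
    wx≡0 = front .zero-beyond x λ i i≤r W′ → ℕ.<⇒≱ (1+r-min i W′) i≤r
    shift≡apply : shift k w x ≡ apply w x
    shift≡apply = ≡.trans (≡.cong (λ b → apply w x ℤ.- k ℤ.* b) wx≡0)
      (≡.trans (≡.cong (λ b → apply w x ℤ.- b) (ℤ.*-zeroʳ k)) (ℤ.+-identityʳ (apply w x)))
    -- No neighbour of `x` is closer than r: either it is at distance exactly r, or `w` vanishes
    -- there.
    neighbour≥0 : ∀ {j} → x ~ j → 0ℤ ℤ.≤ w j
    neighbour≥0 {j} x~j with walk? j v r
    ... | yes W′ = ℤ.<⇒≤ (front .positive-at j (W′ , farther x~j))
    ... | no ¬W′ = ℤ.≤-reflexive (≡.sym (front .zero-beyond j λ i i≤r W′ →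
                     ¬W′ (≡.subst (Walk G j v) (ℕ.≤-antisym i≤r (farther x~j i W′)) W′)))
    term≥0 : ∀ j → 0ℤ ℤ.≤ adjacency x j ℤ.* w j
    term≥0 j with x ~? j
    ... | no  _   = ℤ.≤-reflexive (≡.sym (ℤ.*-zeroˡ (w j)))
    ... | yes x~j = ≡.subst (0ℤ ℤ.≤_) (≡.sym (ℤ.*-identityˡ (w j))) (neighbour≥0 x~j)
    term>0 : 0ℤ ℤ.< adjacency x z ℤ.* w z
    term>0 rewrite dec-true (x ~? z) x~z =
      ≡.subst (0ℤ ℤ.<_) (≡.sym (ℤ.*-identityˡ (w z))) (front .positive-at z (W , farther x~z))

  frontier-shifts : ∀ {v r w} ks → Frontier v r w → Frontier v (List.length ks ℕ.+ r) (shifts ks w)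
  frontier-shifts []       front = front
  frontier-shifts {v} {r} {w} (k ∷ ks) front =
    ≡.subst (λ s → Frontier v s (shifts ks (shift k w))) (ℕ.+-suc (List.length ks) r)
      (frontier-shifts ks (frontier-shift k front))

  -- The witness is the indicator vector of `v`: the degree of the product equals the distance, so
  -- its entry at `u` is positive.
  shifts≢0-at-distance : ∀ {u v} ks → IsDistance G u v (List.length ks) → ∃[ w ] shifts ks w u ≢ 0ℤ
  shifts≢0-at-distance {u} {v} ks isDist = _ , λ eq → ℤ.<-irrefl (≡.sym eq)
    (frontier-shifts ks (frontier-𝟙 v) .positive-at u (≡.subst (IsDistance G u v) (≡.sym (ℕ.+-identityʳ _)) isDist))

  -- The factors found over the field have integer roots, and the embedding of ℤ reflects the
  -- vanishing of the product.
  integral⇒shifts : ∀ {c ℓ₁ ℓ₂} (K : AlgebraicallyClosedField c ℓ₁ ℓ₂) → Integral K G →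
                    ∀ w → ¬ ¬ (∃[ ks ] ∀ i → shifts ks w i ≡ 0ℤ)
  integral⇒shifts K integral w none =
    shifts-annihilate (adjacencyMatrix K G) integral (⟦_⟧ ∘ w) λ (ks , eq) →
      none (ks , λ i → ⟦⟧-injective-0 _ (trans (⟦⟧-homo-shifts ⟦adjacency⟧ ks w i) (eq i)))
    where
    open AlgebraicallyClosedField K using (commutativeRing; _≈_; trans; refl; +-identityʳ)
    open ClosedField K
    open IntegerMultiples commutativeRing using (⟦_⟧)
    open Reduction commutativeRing (adjacencyMatrix K G) adjacency
    ⟦adjacency⟧ : ∀ i j → ⟦ adjacency i j ⟧ ≈ adjacencyMatrix K G i j
    ⟦adjacency⟧ i j with i ~? j
    ... | yes _ = +-identityʳ _
    ... | no  _ = refl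

-- Positions in lists and sizes of decidable subsets.

lookup-injective : ∀ {a} {A : Set a} {xs : List A} → Unique xs → ∀ {i j} → List.lookup xs i ≡ List.lookup xs j → i ≡ j
lookup-injective (_  ∷ _)  {zero}  {zero}  eq = ≡.refl
lookup-injective (x∉ ∷ _)  {zero}  {suc j} eq = contradiction eq (All.lookup x∉ (∈-lookup j))
lookup-injective (x∉ ∷ _)  {suc i} {zero}  eq = contradiction (≡.sym eq) (All.lookup x∉ (∈-lookup i))
lookup-injective (_  ∷ xs) {suc i} {suc j} eq = ≡.cong suc (lookup-injective xs eq)

∣tabulate∣ : ∀ {n} (b : Fin n → Bool) → sum (𝟙 ∘ b) ≡ + Subset.∣ Vec.tabulate b ∣
∣tabulate∣ {zero}  b = ≡.refl
∣tabulate∣ {suc n} b with b zero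
... | true  = ≡.cong (ℤ._+_ 1ℤ) (∣tabulate∣ (b ∘ suc))
... | false = ≡.trans (ℤ.+-identityˡ _) (∣tabulate∣ (b ∘ suc))

∈-tabulate-does : ∀ {n p} {P : Fin n → Set p} (P? : Decidable P) {i} → i Subset.∈ Vec.tabulate (does ∘ P?) → P i
∈-tabulate-does P? {i} i∈ with P? i | ≡.trans (≡.sym (lookup∘tabulate (does ∘ P?) i)) ([]=⇒lookup i∈)
... | yes p | _ = p

-- Edges, walks and stars in the line graph.

module LineGraph (Γ : Graph) where
  open Graph Γ
  L = lineGraph Γ
  open Graph L using () renaming (order to size; _~?_ to _~ᴸ?_; Vertex to Edge)

  ends : Edge → Vertex × Vertex
  ends = List.lookup (edges Γ)

  tail head : Edge → Vertex
  tail e = proj₁ (ends e)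
  head e = proj₂ (ends e)

  ends-isEdge : ∀ e → IsEdge Γ (ends e)
  ends-isEdge e = proj₂ (∈-filter⁻ (isEdge? Γ) {xs = List.cartesianProduct (List.allFin order) (List.allFin order)} (∈-lookup e))

  tail≢head : ∀ e → tail e ≢ head e
  tail≢head e = Fin.<⇒≢ (proj₁ (ends-isEdge e))

  ends-injective : ∀ {e f} → ends e ≡ ends f → e ≡ f
  ends-injective = lookup-injective (filter⁺ (isEdge? Γ) (cartesianProduct⁺ (allFin⁺ order) (allFin⁺ order)))

  -- Edges are listed with tail below head, so two edges with the same ends agree as ordered pairs;
  -- a crossed match would reverse the order.
  common-ends : ∀ {e f} → IsEndpoint Γ (tail e) (ends f) → IsEndpoint Γ (head e) (ends f) → e ≡ f
  common-ends {e} {f} (inj₁ t≡t) (inj₂ h≡h) = ends-injective (≡.cong₂ _,_ t≡t h≡h)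
  common-ends {e} {f} (inj₁ t≡t) (inj₁ h≡t) = contradiction (≡.trans t≡t (≡.sym h≡t)) (tail≢head e)
  common-ends {e} {f} (inj₂ t≡h) (inj₂ h≡h) = contradiction (≡.trans t≡h (≡.sym h≡h)) (tail≢head e)
  common-ends {e} {f} (inj₂ t≡h) (inj₁ h≡t) = contradiction
    (≡.subst₂ Fin._<_ t≡h h≡t (proj₁ (ends-isEdge e))) (Fin.<-asym (proj₁ (ends-isEdge f)))

  edge : ∀ {u v} → u ~ v → ∃[ e ] IsEndpoint Γ u (ends e) × IsEndpoint Γ v (ends e)
  edge {u} {v} u~v with Fin.<-cmp u v
  ... | tri≈ _ u≡v _ = contradiction u~v (~-irrefl u≡v)
  ... | tri< u<v _ _ = index uv∈ , inj₁ (≡.cong proj₁ (lookup-index uv∈)) , inj₂ (≡.cong proj₂ (lookup-index uv∈))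
    where uv∈ = ∈-filter⁺ (isEdge? Γ) (∈-cartesianProduct⁺ (∈-allFin u) (∈-allFin v)) (u<v , u~v)
  ... | tri> _ _ v<u = index vu∈ , inj₂ (≡.cong proj₂ (lookup-index vu∈)) , inj₁ (≡.cong proj₁ (lookup-index vu∈))
    where vu∈ = ∈-filter⁺ (isEdge? Γ) (∈-cartesianProduct⁺ (∈-allFin v) (∈-allFin u)) (v<u , ~-sym u~v)

  -- The edges traversed by a walk in Γ form a walk in `L`; an edge equal to the current one is
  -- skipped, as `L` has no loops.
  connect : ∀ {x y k e f} → Walk Γ x y k → IsEndpoint Γ x (ends e) → IsEndpoint Γ y (ends f) → ∃[ l ] Walk L e f l
  connect {e = e} {f} [] x∈e x∈f with e Fin.≟ f
  ... | yes ≡.refl = 0 , []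
  ... | no  e≢f    = 1 , (e≢f , _ , x∈e , x∈f) ∷ []
  connect {e = e} {f} (x~z ∷ W) x∈e y∈f with edge x~z
  ... | g , x∈g , z∈g with e Fin.≟ g | connect {e = g} W z∈g y∈f
  ...   | yes ≡.refl | l , W′ = l , W′
  ...   | no  e≢g    | l , W′ = suc l , (e≢g , _ , x∈e , x∈g) ∷ W′

  connected : Connected Γ → Connected L
  connected conn e f = connect (proj₂ (conn (tail e) (tail f))) (inj₁ ≡.refl) (inj₁ ≡.refl)

  incidence : Vertex → Edge → ℤ
  incidence x e = 𝟙 (does (isEndpoint? Γ x (ends e)))

  incidence-nonNeg : ∀ x e → 0ℤ ℤ.≤ incidence x e
  incidence-nonNeg x e = 𝟙-nonNeg (does (isEndpoint? Γ x (ends e)))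

  star : Vertex → Subset size
  star x = Vec.tabulate (λ e → does (isEndpoint? Γ x (ends e)))

  star-isClique : ∀ x → IsClique L (star x)
  star-isClique x e∈ f∈ e≢f = e≢f , x , ∈-tabulate-does incident? e∈ , ∈-tabulate-does incident? f∈
    where
    incident? : Decidable (λ e → IsEndpoint Γ x (ends e))
    incident? e = isEndpoint? Γ x (ends e)

  incidence-split : ∀ x e → incidence x e ≡ 𝟙 (does (x Fin.≟ tail e)) ℤ.+ 𝟙 (does (x Fin.≟ head e))
  incidence-split x e with x Fin.≟ tail e | x Fin.≟ head e
  ... | yes x≡t | yes x≡h = contradiction (≡.trans (≡.sym x≡t) x≡h) (tail≢head e)
  ... | yes _   | no _    = ≡.refl
  ... | no _    | yes _   = ≡.refl
  ... | no _    | no _    = ≡.refl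

  sum-incidence : ∀ e (g : Vector ℤ order) → sum (λ x → incidence x e ℤ.* g x) ≡ g (tail e) ℤ.+ g (head e)
  sum-incidence e g = begin
    sum (λ x → incidence x e ℤ.* g x)
      ≡⟨ sum-cong-≗ (λ x → ≡.trans (≡.cong (ℤ._* g x) (incidence-split x e)) (ℤ.*-distribʳ-+ (g x) (𝟙 (does (x Fin.≟ tail e))) (𝟙 (does (x Fin.≟ head e))))) ⟩
    sum (λ x → 𝟙 (does (x Fin.≟ tail e)) ℤ.* g x ℤ.+ 𝟙 (does (x Fin.≟ head e)) ℤ.* g x)
      ≡⟨ ∑-distrib-+ (λ x → 𝟙 (does (x Fin.≟ tail e)) ℤ.* g x) (λ x → 𝟙 (does (x Fin.≟ head e)) ℤ.* g x) ⟩
    sum (λ x → 𝟙 (does (x Fin.≟ tail e)) ℤ.* g x) ℤ.+ sum (λ x → 𝟙 (does (x Fin.≟ head e)) ℤ.* g x)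
      ≡⟨ ≡.cong₂ ℤ._+_ (sum-𝟙≟ (tail e) g) (sum-𝟙≟ (head e) g) ⟩
    g (tail e) ℤ.+ g (head e) ∎
    where open ≡.≡-Reasoning

  -- The entries of Nᵀ N = A + 2. An edge shares both ends with itself, and distinct edges share at
  -- most one end.
  incidence-adjacency : ∀ e f → incidence (tail e) f ℤ.+ incidence (head e) f
                        ≡ adjacency L e f ℤ.+ 𝟙 (does (f Fin.≟ e)) ℤ.* + 2
  incidence-adjacency e f with f Fin.≟ e
  ... | yes ≡.refl = ≡.trans
    (≡.cong₂ ℤ._+_ (𝟙-yes (isEndpoint? Γ (tail e) (ends e)) (inj₁ ≡.refl)) (𝟙-yes (isEndpoint? Γ (head e) (ends e)) (inj₂ ≡.refl)))
    (≡.sym (≡.cong (ℤ._+ + 2) (𝟙-no (e ~ᴸ? e) (λ e~e → proj₁ e~e ≡.refl))))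
  ... | no f≢e = ≡.trans
    (distinct (isEndpoint? Γ (tail e) (ends f)) (isEndpoint? Γ (head e) (ends f)))
    (≡.sym (ℤ.+-identityʳ (adjacency L e f)))
    where
    distinct : (t? : Dec (IsEndpoint Γ (tail e) (ends f))) (h? : Dec (IsEndpoint Γ (head e) (ends f))) →
               𝟙 (does t?) ℤ.+ 𝟙 (does h?) ≡ adjacency L e f
    distinct (yes t∈f) (yes h∈f) = contradiction (≡.sym (common-ends t∈f h∈f)) f≢e
    distinct (yes t∈f) (no _)    = ≡.sym (𝟙-yes (e ~ᴸ? f) (f≢e ∘ ≡.sym , tail e , inj₁ ≡.refl , t∈f))
    distinct (no _)    (yes h∈f) = ≡.sym (𝟙-yes (e ~ᴸ? f) (f≢e ∘ ≡.sym , head e , inj₂ ≡.refl , h∈f))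
    distinct (no t∉f)  (no h∉f)  = ≡.sym (𝟙-no (e ~ᴸ? f) λ
      { (_ , _ , inj₁ ≡.refl , t∈f) → t∉f t∈f
      ; (_ , _ , inj₂ ≡.refl , h∈f) → h∉f h∈f
      })

  -- The Gram matrix of the incidence matrix and the bound on distances.

  open MatrixAction ℤ.+-*-commutativeRing (adjacency L)
  open Gram incidence

  gram≡apply+2 : ∀ y e → gram y e ≡ apply y e ℤ.+ + 2 ℤ.* y e
  gram≡apply+2 y e = begin
    gram y e
      ≡⟨ sum-incidence e (image y) ⟩
    image y (tail e) ℤ.+ image y (head e)
      ≡⟨ ∑-distrib-+ (λ f → incidence (tail e) f ℤ.* y f) (λ f → incidence (head e) f ℤ.* y f) ⟨
    sum (λ f → incidence (tail e) f ℤ.* y f ℤ.+ incidence (head e) f ℤ.* y f)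
      ≡⟨ sum-cong-≗ term ⟩
    sum (λ f → adjacency L e f ℤ.* y f ℤ.+ 𝟙 (does (f Fin.≟ e)) ℤ.* (+ 2 ℤ.* y f))
      ≡⟨ ∑-distrib-+ (λ f → adjacency L e f ℤ.* y f) (λ f → 𝟙 (does (f Fin.≟ e)) ℤ.* (+ 2 ℤ.* y f)) ⟩
    apply y e ℤ.+ sum (λ f → 𝟙 (does (f Fin.≟ e)) ℤ.* (+ 2 ℤ.* y f))
      ≡⟨ ≡.cong (ℤ._+_ (apply y e)) (sum-𝟙≟ e (λ f → + 2 ℤ.* y f)) ⟩
    apply y e ℤ.+ + 2 ℤ.* y e ∎
    where
    open ≡.≡-Reasoning
    expand : ∀ a d y → (a ℤ.+ d ℤ.* + 2) ℤ.* y ≡ a ℤ.* y ℤ.+ d ℤ.* (+ 2 ℤ.* y)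
    expand = solve-∀
    term : ∀ f → incidence (tail e) f ℤ.* y f ℤ.+ incidence (head e) f ℤ.* y f
               ≡ adjacency L e f ℤ.* y f ℤ.+ 𝟙 (does (f Fin.≟ e)) ℤ.* (+ 2 ℤ.* y f)
    term f = begin
      incidence (tail e) f ℤ.* y f ℤ.+ incidence (head e) f ℤ.* y f
        ≡⟨ ℤ.*-distribʳ-+ (y f) (incidence (tail e) f) (incidence (head e) f) ⟨
      (incidence (tail e) f ℤ.+ incidence (head e) f) ℤ.* y f
        ≡⟨ ≡.cong (ℤ._* y f) (incidence-adjacency e f) ⟩
      (adjacency L e f ℤ.+ 𝟙 (does (f Fin.≟ e)) ℤ.* + 2) ℤ.* y f
        ≡⟨ expand (adjacency L e f) (𝟙 (does (f Fin.≟ e))) (y f) ⟩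
      adjacency L e f ℤ.* y f ℤ.+ 𝟙 (does (f Fin.≟ e)) ℤ.* (+ 2 ℤ.* y f) ∎

  module _ {ω : ℕ} (ω-max : ∀ S → IsClique L S → Subset.∣ S ∣ ℕ.≤ ω) where

    degree≤ω : ∀ x → sum (incidence x) ℤ.≤ + ω
    degree≤ω x = ≡.subst (ℤ._≤ + ω) (≡.sym (∣tabulate∣ (λ e → does (isEndpoint? Γ x (ends e)))))
      (ℤ.+≤+ (ω-max (star x) (star-isClique x)))

    endpoints≤2 : ∀ e → sum (λ x → incidence x e) ℤ.≤ + 2
    endpoints≤2 e = ℤ.≤-reflexive (≡.trans (sum-cong-≗ (λ x → ≡.sym (ℤ.*-identityʳ (incidence x e)))) (sum-incidence e (λ _ → 1ℤ)))

    -- The integers -2, ..., D - 3. There are exactly D of them, and for 2ω < D they include every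
    -- possible eigenvalue -2, ..., 2ω - 2.
    spectrum : ℕ → List ℤ
    spectrum = List.applyUpTo (λ j → + j ℤ.- + 2)

    -- Here k + 2 is an eigenvalue of Nᵀ N, hence a natural number at most 2ω, and it serves as the
    -- index of k in the list.
    eigenvalue∈spectrum : ∀ {D} → 2 ℕ.* ω ℕ.< D → ∀ k y → (∀ e → shift k y e ≡ 0ℤ) → (∃[ e ] y e ≢ 0ℤ) → k ∈ spectrum D
    eigenvalue∈spectrum {D} 2ω<D k y eigen y≢0 =
      ≡.subst (_∈ spectrum D) (≡.trans (≡.cong (ℤ._- + 2) θ≡) (cancel k)) (∈-applyUpTo⁺ (λ j → + j ℤ.- + 2) θ<D)
      where
      cancel : ∀ k → k ℤ.+ + 2 ℤ.- + 2 ≡ k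
      cancel = solve-∀
      regroup : ∀ a k y → a ℤ.+ + 2 ℤ.* y ≡ (a ℤ.- k ℤ.* y) ℤ.+ (k ℤ.+ + 2) ℤ.* y
      regroup = solve-∀
      gram-eigen : ∀ e → gram y e ≡ (k ℤ.+ + 2) ℤ.* y e
      gram-eigen e = ≡.trans (gram≡apply+2 y e) (≡.trans (regroup (apply y e) k (y e))
        (≡.trans (≡.cong (ℤ._+ (k ℤ.+ + 2) ℤ.* y e) (eigen e)) (ℤ.+-identityˡ _)))
      θ≡ : + ∣ k ℤ.+ + 2 ∣ ≡ k ℤ.+ + 2
      θ≡ = ℤ.0≤i⇒+∣i∣≡i (eigenvalue-nonNeg gram-eigen y≢0)
      θ≤ω*2 : + ∣ k ℤ.+ + 2 ∣ ℤ.≤ + (ω ℕ.* 2)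
      θ≤ω*2 = ≡.subst₂ ℤ._≤_ (≡.sym θ≡) (≡.sym (ℤ.pos-* ω 2))
        (eigenvalue-≤ gram-eigen y≢0 incidence-nonNeg ω degree≤ω 2 endpoints≤2)
      θ<D : ∣ k ℤ.+ + 2 ∣ ℕ.< D
      θ<D = ℕ.≤-<-trans (ℤ.drop‿+≤+ θ≤ω*2) (≡.subst (ℕ._< D) (ℕ.*-comm 2 ω) 2ω<D)

    distance≤2ω : ∀ {c ℓ₁ ℓ₂} (K : AlgebraicallyClosedField c ℓ₁ ℓ₂) → Integral K L →
                  ∀ {e f D} → IsDistance L e f D → D ℕ.≤ 2 ℕ.* ω
    distance≤2ω K integral {e} {f} {D} isDist = decidable-stable (D ℕ.≤? 2 ℕ.* ω) λ D≰2ω →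
      let w , w≢0 = shifts≢0-at-distance L (spectrum D)
                      -- The number of factors has to equal the distance for the entry to be
                      -- nonzero.
                      (≡.subst (IsDistance L e f) (≡.sym (List.length-applyUpTo (λ j → + j ℤ.- + 2) D)) isDist)
      in integral⇒shifts L K integral w λ (ks , eq) →
        w≢0 (shifts-spectrum (spectrum D) (eigenvalue∈spectrum (ℕ.≰⇒> D≰2ω)) ks w eq e)
      where open SymmetricIntegerMatrix (adjacency L) (adjacency-sym L)

open import Data.Nat.Base using (_*_; _≤_)

corollary1p6 :
  ∀ {c ℓ₁ ℓ₂} (K : AlgebraicallyClosedField c ℓ₁ ℓ₂) (Γ : Graph) →
  Connected Γ → Bipartite Γ → HasEdge Γ →
  Integral K (lineGraph Γ) →
  ∃[ D ] ∃[ ω ] IsDiameter (lineGraph Γ) D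
              × IsCliqueNumber (lineGraph Γ) ω
              × D ≤ 2 * ω
corollary1p6 K Γ conn _ (_ , _ , u~v) integral =
  let open LineGraph Γ
      -- The given edge of Γ is a vertex of `L`, and the pair `e`, `f` attains the diameter.
      D , isDiam@(_ , e , f , isDist) = connected⇒diameter L (connected conn) (proj₁ (edge u~v))
      ω , isCliqueNumber = cliqueNumber L
  in D , ω , isDiam , isCliqueNumber , distance≤2ω (proj₂ isCliqueNumber) K integral isDist
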